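{- Let $G$ be a connected graph with no isolated vertices. If either (a) $\gamma_t(G)=\gamma_c(G)$, or (b) $\gamma_t(G)=\gamma_c(G)-1$, then $$\gamma_t(G) \ge \left\lceil \frac{3\gamma(G)+2\gamma_c(G)}{6}\right\rceil.$$
   Context: All graphs are finite, simple and undirected. A set $S\subseteq V(G)$ is a dominating set if every vertex not in $S$ is adjacent to some vertex of $S$; $\gamma(G)$ is the minimum size of a dominating set. A set $S$ is a total dominating set if every vertex of $G$ (including those in $S$) is adjacent to some vertex of $S$; $\gamma_t(G)$ is the minimum size of a total dominating set. A set $S$ is a connected dominating set if it is dominating and the subgraph induced by $S$ is connected; $\gamma_c(G)$ is the minimum size of a connected dominating set. -}

module Defs where

open import Data.Bool.Base using (true; false)
open import Data.Empty using (⊥-elim)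
open import Data.Fin.Base using (Fin; zero; suc)
open import Data.Fin.Properties using (all?; any?) renaming (_≟_ to _≟ᶠ_)
open import Data.Fin.Subset using (Subset; _∈_; _∉_; ∣_∣; ⊤)
open import Data.Fin.Subset.Properties using (_∈?_; ∈⊤; anySubset?)
open import Data.List.Base using (List; []; _∷_; map)
open import Data.List.Membership.Propositional using () renaming (_∈_ to _∈ˡ_)
open import Data.List.Membership.Propositional.Properties using (∈-map⁺)
import Data.List.Relation.Unary.All as All
import Data.List.Relation.Unary.Any as Any
open import Data.List.Relation.Unary.Any.Properties using (¬Any[])
open import Data.Nat.Base using (ℕ; _≤_; _<_)
open import Data.Nat.Induction using (<-wellFounded)
open import Data.Nat.Properties using (_<?_; ≮⇒≥)
open import Data.Product.Base using (∃; _×_; _,_; proj₁; proj₂)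
open import Data.Sum.Base using (_⊎_; inj₁; inj₂)
open import Data.Vec.Base using ([]; _∷_; here; there)
open import Data.Vec.Properties.WithK using ([]=-irrelevant)
open import Function.Base using (id; _on_)
open import Induction.WellFounded using (Acc; acc)
open import Level using (0ℓ)
open import Relation.Binary.Construct.Closure.ReflexiveTransitive using (Star; ε; _◅_; _◅◅_; gmap)
open import Relation.Binary.Core using (Rel)
open import Relation.Binary.Definitions using (Irreflexive; Symmetric; DecidableEquality) renaming (Decidable to Decidable₂)
open import Relation.Binary.PropositionalEquality.Core using (_≡_; refl; cong; subst₂)
open import Relation.Nullary.Decidable using (Dec; yes; no; map′; ¬?; _×-dec_; _⊎-dec_; _→-dec_)
open import Relation.Unary using (Pred; Decidable)

record Graph (n : ℕ) : Set₁ where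
  field
    Adj    : Rel (Fin n) 0ℓ
    adj?   : Decidable₂ Adj
    sym    : Symmetric Adj
    irrefl : Irreflexive _≡_ Adj

open Graph public

-- The null graph does not count as connected.
Connected : {V : Set} → Rel V 0ℓ → Set
Connected {V} E = V × (∀ (x y : V) → Star E x y)

ConnectedGraph : ∀ {n} → Graph n → Set
ConnectedGraph G = Connected (Adj G)

InducedVertex : ∀ {n} → Subset n → Set
InducedVertex S = ∃ (_∈ S)

InducedAdj : ∀ {n} → Graph n → (S : Subset n) → Rel (InducedVertex S) 0ℓ
InducedAdj G S = Adj G on proj₁

NoIsolatedVertices : ∀ {n} → Graph n → Set
NoIsolatedVertices G = ∀ v → ∃ λ u → Adj G v u

Dominating : ∀ {n} → Graph n → Pred (Subset n) 0ℓ
Dominating G S = ∀ v → v ∉ S → ∃ λ u → u ∈ S × Adj G v u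

TotalDominating : ∀ {n} → Graph n → Pred (Subset n) 0ℓ
TotalDominating G S = ∀ v → ∃ λ u → u ∈ S × Adj G v u

ConnectedDominating : ∀ {n} → Graph n → Pred (Subset n) 0ℓ
ConnectedDominating G S = Dominating G S × Connected (InducedAdj G S)

IsMinimumSize : ∀ {n} → Pred (Subset n) 0ℓ → ℕ → Set
IsMinimumSize P k = (∃ λ S → P S × ∣ S ∣ ≡ k) × (∀ S → P S → k ≤ ∣ S ∣)

minimumSize : ∀ {n} {P : Pred (Subset n) 0ℓ} → Decidable P → ∃ P → ∃ (IsMinimumSize P)
minimumSize {P = P} P? (S₀ , p₀) = go S₀ p₀ (<-wellFounded ∣ S₀ ∣)
  where
  go : ∀ S → P S → Acc _<_ ∣ S ∣ → ∃ (IsMinimumSize P)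
  go S p (acc rs) with anySubset? (λ T → P? T ×-dec (∣ T ∣ <? ∣ S ∣))
  ... | yes (T , q , T<S) = go T q (rs T<S)
  ... | no ¬smaller =
    ∣ S ∣ , (S , p , refl) , λ T q → ≮⇒≥ (λ T<S → ¬smaller (T , q , T<S))

-- Connectedness of a decidable relation on an enumerated type is decidable
-- (Warshall): Via l x y holds when x reaches y with all intermediate
-- vertices taken from l.
module _ {V : Set} (_≟_ : DecidableEquality V) {E : Rel V 0ℓ} (E? : Decidable₂ E) where

  private
    Via : List V → Rel V 0ℓ
    Via []      x y = x ≡ y ⊎ E x y
    Via (v ∷ l) x y = Via l x y ⊎ (Via l x v × Via l v y)

    via? : ∀ l → Decidable₂ (Via l)
    via? []      x y = (x ≟ y) ⊎-dec E? x y
    via? (v ∷ l) x y = via? l x y ⊎-dec (via? l x v ×-dec via? l v y)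

    sound : ∀ l {x y} → Via l x y → Star E x y
    sound []      (inj₁ refl)    = ε
    sound []      (inj₂ e)       = e ◅ ε
    sound (v ∷ l) (inj₁ p)       = sound l p
    sound (v ∷ l) (inj₂ (p , q)) = sound l p ◅◅ sound l q

    base : ∀ l {x y} → x ≡ y ⊎ E x y → Via l x y
    base []      p = p
    base (v ∷ l) p = inj₁ (base l p)

    through : ∀ l {x v y} → v ∈ˡ l → Via l x v → Via l v y → Via l x y
    through (v ∷ l) {x} {_} {y} (Any.here refl) p q = inj₂ (into p , from q)
      where
      into : Via (v ∷ l) x v → Via l x v
      into (inj₁ r)       = r
      into (inj₂ (r , _)) = r
      from : Via (v ∷ l) v y → Via l v y
      from (inj₁ r)       = r
      from (inj₂ (_ , r)) = r
    through (w ∷ l) (Any.there i) (inj₁ p)       (inj₁ q)       = inj₁ (through l i p q)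
    through (w ∷ l) (Any.there i) (inj₁ p)       (inj₂ (q , r)) = inj₂ (through l i p q , r)
    through (w ∷ l) (Any.there i) (inj₂ (o , p)) (inj₁ q)       = inj₂ (o , through l i p q)
    through (w ∷ l) (Any.there i) (inj₂ (o , _)) (inj₂ (_ , r)) = inj₂ (o , r)

    complete : ∀ l → (∀ v → v ∈ˡ l) → ∀ {x y} → Star E x y → Via l x y
    complete l full ε        = base l (inj₁ refl)
    complete l full (e ◅ es) = through l (full _) (base l (inj₂ e)) (complete l full es)

  connected? : (l : List V) → (∀ v → v ∈ˡ l) → Dec (Connected E)
  connected? []         full = no λ (v , _) → ¬Any[] (full v)
  connected? l@(v₀ ∷ _) full =
    map′ (λ h → v₀ , λ x y → sound l (All.lookup (All.lookup h (full x)) (full y)))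
         (λ (_ , h) → All.universal (λ x → All.universal (λ y → complete l full (h x y)) l) l)
         (All.all? (λ x → All.all? (via? l x) l) l)

inducedVertices : ∀ {n} (S : Subset n) → List (InducedVertex S)
inducedVertices []          = []
inducedVertices (true ∷ S)  = (zero , here) ∷ map (λ (x , i) → suc x , there i) (inducedVertices S)
inducedVertices (false ∷ S) = map (λ (x , i) → suc x , there i) (inducedVertices S)

inducedVertices-complete : ∀ {n} (S : Subset n) (v : InducedVertex S) → v ∈ˡ inducedVertices S
inducedVertices-complete (true ∷ S)  (zero , here)      = Any.here refl
inducedVertices-complete (true ∷ S)  (suc x , there i)  =
  Any.there (∈-map⁺ _ (inducedVertices-complete S (x , i)))
inducedVertices-complete (false ∷ S) (suc x , there i) =
  ∈-map⁺ _ (inducedVertices-complete S (x , i))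

inducedVertex-≡ : ∀ {n} {S : Subset n} {v w : InducedVertex S} → proj₁ v ≡ proj₁ w → v ≡ w
inducedVertex-≡ {v = x , i} {w = .x , j} refl = cong (x ,_) ([]=-irrelevant i j)

dominating? : ∀ {n} (G : Graph n) → Decidable (Dominating G)
dominating? G S = all? λ v → ¬? (v ∈? S) →-dec any? λ u → (u ∈? S) ×-dec adj? G v u

totalDominating? : ∀ {n} (G : Graph n) → Decidable (TotalDominating G)
totalDominating? G S = all? λ v → any? λ u → (u ∈? S) ×-dec adj? G v u

connectedDominating? : ∀ {n} (G : Graph n) → Decidable (ConnectedDominating G)
connectedDominating? G S =
  dominating? G S ×-dec
  connected? (λ v w → map′ inducedVertex-≡ (cong proj₁) (proj₁ v ≟ᶠ proj₁ w))
             (λ v w → adj? G (proj₁ v) (proj₁ w))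
             (inducedVertices S) (inducedVertices-complete S)

⊤-dominating : ∀ {n} (G : Graph n) → Dominating G ⊤
⊤-dominating G v v∉⊤ = ⊥-elim (v∉⊤ ∈⊤)

⊤-totalDominating : ∀ {n} (G : Graph n) → NoIsolatedVertices G → TotalDominating G ⊤
⊤-totalDominating G noIso v = let u , a = noIso v in u , ∈⊤ , a

⊤-connectedDominating : ∀ {n} (G : Graph n) → ConnectedGraph G → ConnectedDominating G ⊤
⊤-connectedDominating G (v₀ , reach) =
  ⊤-dominating G , (v₀ , ∈⊤) , λ x y →
    subst₂ (Star (InducedAdj G ⊤)) (inducedVertex-≡ refl) (inducedVertex-≡ refl)
      (gmap (_, ∈⊤) id (reach (proj₁ x) (proj₁ y)))

domination : ∀ {n} (G : Graph n) → ∃ (IsMinimumSize (Dominating G))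
domination G = minimumSize (dominating? G) (⊤ , ⊤-dominating G)

totalDomination : ∀ {n} (G : Graph n) → NoIsolatedVertices G → ∃ (IsMinimumSize (TotalDominating G))
totalDomination G noIso = minimumSize (totalDominating? G) (⊤ , ⊤-totalDominating G noIso)

connectedDomination : ∀ {n} (G : Graph n) → ConnectedGraph G → ∃ (IsMinimumSize (ConnectedDominating G))
connectedDomination G conn = minimumSize (connectedDominating? G) (⊤ , ⊤-connectedDominating G conn)

γ : ∀ {n} → Graph n → ℕ
γ G = proj₁ (domination G)

-- A total dominating set exists only without isolated vertices, and a
-- connected dominating set only in a connected graph, so γₜ and γc take
-- these hypotheses as arguments; their values do not depend on the proofs.
γₜ : ∀ {n} (G : Graph n) → NoIsolatedVertices G → ℕ
γₜ G noIso = proj₁ (totalDomination G noIso)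

γc : ∀ {n} (G : Graph n) → ConnectedGraph G → ℕ
γc G conn = proj₁ (connectedDomination G conn)

{-# OPTIONS --safe #-}

-- Every total dominating set is dominating, so γ ≤ γₜ.  It contains a neighbour
-- u of some vertex and a neighbour of u, so 2 ≤ γₜ.  Hence, as γc ≤ γₜ + 1,
-- 3γ + 2γc ≤ 5γₜ + 2 ≤ 6γₜ.
module Submission where

open import Defs
open import Data.Fin.Base using (Fin)
open import Data.Fin.Subset using (Subset; _∈_; ∣_∣)
open import Data.Fin.Subset.Properties using (x∈p∧x≢y⇒x∈p-y; x∈p⇒∣p-x∣<∣p∣)
open import Data.Nat.Base as ℕ using (ℕ; suc; _+_; _*_; z≤n)
import Data.Nat.Properties as ℕ
open import Data.Nat.Solver using (module +-*-Solver)
open import Data.Integer.Base as ℤ using (+_; _≥_)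
open import Data.Integer.DivMod using (n<s[n/ℕd]*d; div-pos-is-/ℕ)
import Data.Integer.Properties as ℤ
open import Data.Product.Base using (_,_; proj₂)
open import Data.Rational.Base as ℚ using (_/_; ceiling; floor; ↥_; ↧_; ↧ₙ_)
import Data.Rational.Properties as ℚ
open import Data.Rational.Unnormalised.Base using (mkℚᵘ; *≤*) renaming (↥_ to ↥ᵘ_; ↧_ to ↧ᵘ_; _≤_ to _≤ᵘ_)
import Data.Rational.Unnormalised.Properties as ℚᵘ
open import Data.Sum.Base using (_⊎_; inj₁; inj₂)
open import Relation.Binary.PropositionalEquality.Core using (_≡_; _≢_; refl; cong) renaming (sym to ≡-sym)

-- Since `γₜ` is an integer, the ceiling lies below it as soon as 3γ + 2γc ≤ 6γₜ; `ceiling-/-least`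
-- makes this reduction. Both alternatives give γc ≤ γₜ + 1, and with `γ≤γₜ` the left side is at
-- most 5γₜ + 2; `2≤γₜ` absorbs the remaining 2.

floor-greatest : ∀ {k} p → k ℤ.* ↧ p ℤ.≤ ↥ p → k ℤ.≤ floor p
floor-greatest {k} p@record{} k*d≤n = begin
  k                ≤⟨ ℤ.i<j⇒i≤pred[j] k<1+q ⟩
  ℤ.pred (ℤ.suc q) ≡⟨ ℤ.pred-suc q ⟩
  q                ≡⟨ div-pos-is-/ℕ (↥ p) (↧ₙ p) ⟨
  floor p          ∎
  where
  open ℤ.≤-Reasoning
  q = ↥ p ℤ./ℕ ↧ₙ p

  -- Division with remainder gives n < (1 + q) * d, so k * d < (1 + q) * d, and the positive d
  -- cancels.
  k<1+q : k ℤ.< ℤ.suc q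
  k<1+q = ℤ.*-cancelʳ-<-nonNeg (↧ p) (ℤ.≤-<-trans k*d≤n (n<s[n/ℕd]*d (↥ p) (↧ₙ p)))

ceiling-least : ∀ {k} p → ↥ p ℤ.≤ k ℤ.* ↧ p → ceiling p ℤ.≤ k
ceiling-least {k} p@record{} n≤k*d = begin
  ℤ.- floor (ℚ.- p) ≤⟨ ℤ.neg-mono-≤ (floor-greatest (ℚ.- p) -k*d≤-n) ⟩
  ℤ.- (ℤ.- k)       ≡⟨ ℤ.neg-involutive k ⟩
  k                 ∎
  where
  open ℤ.≤-Reasoning
  -k*d≤-n : ℤ.- k ℤ.* ↧ (ℚ.- p) ℤ.≤ ↥ (ℚ.- p)
  -k*d≤-n = begin
    ℤ.- k ℤ.* ↧ (ℚ.- p) ≡⟨ cong (ℤ.- k ℤ.*_) (ℚ.↧-neg p) ⟩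
    ℤ.- k ℤ.* ↧ p       ≡⟨ ℤ.neg-distribˡ-* k (↧ p) ⟨
    ℤ.- (k ℤ.* ↧ p)     ≤⟨ ℤ.neg-mono-≤ n≤k*d ⟩
    ℤ.- ↥ p             ≡⟨ ℚ.↥-neg p ⟨
    ↥ (ℚ.- p)           ∎

-- `i / n` is reduced to lowest terms, so its numerator and denominator need not be `i` and `n`. The
-- bound is moved to the reduced form through unnormalised rationals, as i/n ≤ k/1.
ceiling-/-least : ∀ {k} i n .{{_ : ℕ.NonZero n}} → i ℤ.≤ k ℤ.* + n → ceiling (i / n) ℤ.≤ k
ceiling-/-least {k} i n@(suc n-1) i≤k*n = ceiling-least (i / n) (begin
  ↥ (i / n)              ≡⟨ ℚ.↥ᵘ-toℚᵘ (i / n) ⟨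
  ↥ᵘ r                   ≡⟨ ℤ.*-identityʳ _ ⟨
  ↥ᵘ r ℤ.* + 1           ≤⟨ ℚᵘ.drop-*≤* i/n≤k ⟩
  k ℤ.* ↧ᵘ r             ≡⟨ cong (k ℤ.*_) (ℚ.↧ᵘ-toℚᵘ (i / n)) ⟩
  k ℤ.* ↧ (i / n)        ∎)
  where
  open ℤ.≤-Reasoning
  r = ℚ.toℚᵘ (i / n)

  -- `mkℚᵘ` stores the denominator minus one, so `mkℚᵘ k 0` is k/1.
  i/n≤k : r ≤ᵘ mkℚᵘ k 0
  i/n≤k = ℚᵘ.≤-trans (ℚᵘ.≤-reflexive (ℚ.toℚᵘ-fromℚᵘ (mkℚᵘ i n-1)))
            (*≤* {p = mkℚᵘ i n-1} {q = mkℚᵘ k 0}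
                 (ℤ.≤-trans (ℤ.≤-reflexive (ℤ.*-identityʳ i)) i≤k*n))

2≤∣p∣ : ∀ {n} {p : Subset n} {x y : Fin n} → x ∈ p → y ∈ p → x ≢ y → 2 ℕ.≤ ∣ p ∣
2≤∣p∣ x∈p y∈p x≢y =
  ℕ.≤-<-trans (ℕ.≤-<-trans z≤n (x∈p⇒∣p-x∣<∣p∣ (x∈p∧x≢y⇒x∈p-y x∈p x≢y))) (x∈p⇒∣p-x∣<∣p∣ y∈p)

module _ {n} (G : Graph n) where

  totalDominating⇒dominating : ∀ {S} → TotalDominating G S → Dominating G S
  totalDominating⇒dominating dom v _ = dom v

  -- A member u of S that dominates v must itself have a neighbour in S, and this differs from u
  -- because there are no loops.
  totalDominating⇒2≤∣S∣ : ∀ {S} → Fin n → TotalDominating G S → 2 ℕ.≤ ∣ S ∣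
  totalDominating⇒2≤∣S∣ v dom =
    let u , u∈S , _    = dom v
        w , w∈S , u~w = dom u
    in 2≤∣p∣ u∈S w∈S λ u≡w → irrefl G u≡w u~w

  γ≤γₜ : ∀ noIso → γ G ℕ.≤ γₜ G noIso
  γ≤γₜ noIso with totalDomination G noIso
  ... | _ , (S , dom , refl) , _ =
    proj₂ (proj₂ (domination G)) S (totalDominating⇒dominating dom)

  2≤γₜ : ∀ noIso → Fin n → 2 ℕ.≤ γₜ G noIso
  2≤γₜ noIso v with totalDomination G noIso
  ... | _ , (S , dom , refl) , _ = totalDominating⇒2≤∣S∣ v dom

3a+2c≤6t : ∀ {a t c} → a ℕ.≤ t → 2 ℕ.≤ t → c ℕ.≤ suc t → 3 * a + 2 * c ℕ.≤ t * 6
3a+2c≤6t {a} {t} {c} a≤t 2≤t c≤1+t = begin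
  3 * a + 2 * c     ≤⟨ ℕ.+-mono-≤ (ℕ.*-monoʳ-≤ 3 a≤t) (ℕ.*-monoʳ-≤ 2 c≤1+t) ⟩
  3 * t + 2 * suc t ≡⟨ solve 1 (λ t → con 3 :* t :+ con 2 :* (con 1 :+ t) := t :* con 5 :+ con 2) refl t ⟩
  -- The 2 comes from doubling the `suc` in the bound on `c`.
  t * 5 + 2         ≤⟨ ℕ.+-monoʳ-≤ (t * 5) 2≤t ⟩
  t * 5 + t         ≡⟨ solve 1 (λ t → t :* con 5 :+ t := t :* con 6) refl t ⟩
  t * 6             ∎
  where
  open ℕ.≤-Reasoning
  open +-*-Solver

theorem2p8 : ∀ {n : ℕ} (G : Graph n) (conn : ConnectedGraph G) (noIso : NoIsolatedVertices G)
    → (γₜ G noIso ≡ γc G conn) ⊎ (suc (γₜ G noIso) ≡ γc G conn)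
    → + γₜ G noIso ≥ ceiling (+ (3 * γ G + 2 * γc G conn) / 6)
-- Connectedness excludes the null graph; its vertex `v` starts the argument for `2≤γₜ`.
theorem2p8 G conn@(v , _) noIso γₜ≡ = ceiling-/-least (+ (3 * γ G + 2 * γc G conn)) 6
  (ℤ.≤-trans (ℤ.+≤+ (3a+2c≤6t (γ≤γₜ G noIso) (2≤γₜ G noIso v) (γc≤1+γₜ γₜ≡)))
             (ℤ.≤-reflexive (ℤ.pos-* (γₜ G noIso) 6)))
  where
  γc≤1+γₜ : (γₜ G noIso ≡ γc G conn) ⊎ (suc (γₜ G noIso) ≡ γc G conn) → γc G conn ℕ.≤ suc (γₜ G noIso)
  γc≤1+γₜ (inj₁ eq) = ℕ.m≤n⇒m≤1+n (ℕ.≤-reflexive (≡-sym eq))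
  γc≤1+γₜ (inj₂ eq) = ℕ.≤-reflexive (≡-sym eq)
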